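{- Let $O$ be an order with property (itov) such that its neighbourhood order $N(O)$ contains no infinite strictly decreasing sequence, and let $\alpha$ be the order type of a well-ordered linear extension of $N(O)$. Then $O$ has a total binary questionable representation of length at most $2\cdot\alpha+1$ (ordinal product: $\alpha$ copies of $2$); more precisely, an order embedding of $O$ into $\mathrm{Next}(2,2\cdot\alpha+1,(O^{0,1})_{2\cdot\alpha+1})$.
   Context: Orders are partial orders; $x\sim y$ means $x\ne y$ and $x,y$ incomparable. $O_{obs1}$ is the order on $\{a,b,c,d\}$ whose only comparabilities are $a<b$, $c<d$; $O_{obs2}$ is the order on $\{a,b,c,d\}$ whose only comparabilities are $a<b$, $c<d$, $c<b$. An order has property (itov) iff it has no induced suborder isomorphic to $O_{obs1}$ or $O_{obs2}$. For $x$ let $D(x)=\{z:z<x\}$, $U(x)=\{z:z>x\}$. The neighbourhood order $N(O)$ has the same domain as $O$ with $x<_{N(O)}y$ iff $D(x)\subseteq D(y)$, $U(x)\subseteq U(y)$ and at least one of these inclusions is strict. $O^{0,1}$ is the two-element total order $0<1$. For an ordinal $j$, $\mathcal O_j=(O_k)_{k<j}$ is a sequence of orders; $(O')_j$ is the constant sequence. A word of length $\ell\le j$ is a sequence $(x_k)_{k<\ell}$ with $x_k\in\mathrm{Dom}(O_k)$. The question of two words $X,Y$ is $(k,x_k,y_k)$ for the least $k<\min(\mathrm{len}X,\mathrm{len}Y)$ with $x_k\neq y_k$, if it exists. $\mathrm{Next}(i,j,\mathcal O_j)$ ($i<j$) is the partial order on all words of length $\ell$ with $i\le \ell<j$ where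 $X<Y$ iff they have a question $(k,x_k,y_k)$ with $x_k<y_k$ in $O_k$, and words without a question or with question items incomparable are incomparable. A questionable representation of $O$ is an injective map $f$ into some $\mathrm{Next}(i,j,\mathcal O_j)$ with $f(x)<f(y)\iff x<y$; its length is $j$, its width the supremum of $|\mathrm{Dom}(O_k)|$; it is total if all $O_k$ are total orders, binary if total of width 2. -}

module Defs where

open import Data.Fin.Base using (Fin)
import Data.Fin.Base as Fin
open import Data.Fin.Induction using () renaming (<-wellFounded to Fin-<-wellFounded)
import Data.Fin.Properties as Fin
open import Data.Nat.Base using (ℕ; suc; _≤_)
open import Data.Product.Base using (Σ; ∃; Σ-syntax; ∃-syntax; _×_; _,_; proj₁; proj₂)
open import Data.Product.Relation.Binary.Lex.Strict using (×-Lex; ×-isStrictTotalOrder; ×-wellFounded)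
open import Data.Product.Relation.Binary.Pointwise.NonDependent using (≡×≡⇒≡; ≡⇒≡×≡)
open import Data.Refinement using (Refinement; value; _,_)
open import Data.Refinement.Properties using (value-injective)
open import Data.Sum.Base using (_⊎_; inj₁; inj₂)
open import Data.Sum.Relation.Binary.LeftOrder using (_⊎-<_; ⊎-<-isStrictTotalOrder; ⊎-<-wellFounded)
open import Data.Sum.Relation.Binary.Pointwise using (Pointwise-≡⇒≡; ≡⇒Pointwise-≡)
open import Function.Base using (_on_; _∘_)
open import Function.Bundles using (Injection)
open import Induction.WellFounded using (WellFounded)
open import Level using (Level; _⊔_; 0ℓ) renaming (suc to lsuc)
open import Relation.Binary.Bundles using (Setoid; StrictPartialOrder)
import Relation.Binary.Construct.On as On
open import Relation.Binary.Core using (Rel; _⇒_)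
open import Relation.Binary.Definitions using (Trichotomous; tri<; tri≈; tri>)
open import Relation.Binary.Morphism.Structures using (IsOrderMonomorphism; IsOrderIsomorphism)
open import Relation.Binary.PropositionalEquality as ≡ using (_≡_; refl)
open import Relation.Binary.Structures using (IsStrictTotalOrder; IsStrictPartialOrder)
open import Relation.Nullary using (¬_)
open import Relation.Unary using (Pred; _⊆_; _⊂_)

private
  variable
    a b c ℓ ℓ₁ ℓ₂ ℓ₃ ℓ₄ : Level

module _ (P : StrictPartialOrder a ℓ₁ ℓ₂) (Q : StrictPartialOrder b ℓ₃ ℓ₄) where
  private
    module P = StrictPartialOrder P
    module Q = StrictPartialOrder Q

  IsOrderEmbedding : (P.Carrier → Q.Carrier) → Set (a ⊔ ℓ₁ ⊔ ℓ₂ ⊔ ℓ₃ ⊔ ℓ₄)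
  IsOrderEmbedding = IsOrderMonomorphism P._≈_ Q._≈_ P._<_ Q._<_

  -- Equivalently: Q has an induced suborder isomorphic to P.
  OrderEmbedding : Set (a ⊔ b ⊔ ℓ₁ ⊔ ℓ₂ ⊔ ℓ₃ ⊔ ℓ₄)
  OrderEmbedding = Σ[ f ∈ (P.Carrier → Q.Carrier) ] IsOrderEmbedding f

data Four : Set where
  a′ b′ c′ d′ : Four

data _<₁_ : Rel Four 0ℓ where
  a<b : a′ <₁ b′
  c<d : c′ <₁ d′

data _<₂_ : Rel Four 0ℓ where
  a<b : a′ <₂ b′
  c<d : c′ <₂ d′
  c<b : c′ <₂ b′

O-obs1 : StrictPartialOrder 0ℓ 0ℓ 0ℓ
O-obs1 = record
  { Carrier = Four
  ; _≈_ = _≡_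
  ; _<_ = _<₁_
  ; isStrictPartialOrder = record
    { isEquivalence = ≡.isEquivalence
    ; irrefl = λ { refl () }
    ; trans = λ { a<b () ; c<d () }
    ; <-resp-≈ = ≡.resp₂ _<₁_
    }
  }

O-obs2 : StrictPartialOrder 0ℓ 0ℓ 0ℓ
O-obs2 = record
  { Carrier = Four
  ; _≈_ = _≡_
  ; _<_ = _<₂_
  ; isStrictPartialOrder = record
    { isEquivalence = ≡.isEquivalence
    ; irrefl = λ { refl () }
    ; trans = λ { a<b () ; c<d () ; c<b () }
    ; <-resp-≈ = ≡.resp₂ _<₂_
    }
  }

Itov : StrictPartialOrder a ℓ₁ ℓ₂ → Set (a ⊔ ℓ₁ ⊔ ℓ₂)
Itov O = ¬ OrderEmbedding O-obs1 O × ¬ OrderEmbedding O-obs2 O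

module _ (O : StrictPartialOrder a ℓ₁ ℓ₂) where
  open StrictPartialOrder O

  D : Carrier → Pred Carrier ℓ₂
  D x z = z < x

  U : Carrier → Pred Carrier ℓ₂
  U x z = x < z

  _<N_ : Rel Carrier (a ⊔ ℓ₂)
  x <N y = D x ⊆ D y × U x ⊆ U y × (D x ⊂ D y ⊎ U x ⊂ U y)

  N : StrictPartialOrder a ℓ₁ (a ⊔ ℓ₂)
  N = record
    { Carrier = Carrier
    ; _≈_ = _≈_
    ; _<_ = _<N_
    ; isStrictPartialOrder = record
      { isEquivalence = isEquivalence
      ; irrefl = λ where
          x≈y (_ , _ , inj₁ (_ , Dy⊈Dx)) → Dy⊈Dx (<-respʳ-≈ (Eq.sym x≈y))
          x≈y (_ , _ , inj₂ (_ , Uy⊈Ux)) → Uy⊈Ux (<-respˡ-≈ (Eq.sym x≈y))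
      ; trans = λ where
          (D₁ , U₁ , inj₁ (_ , s)) (D₂ , U₂ , _) →
            (λ z → D₂ (D₁ z)) , (λ z → U₂ (U₁ z)) ,
            inj₁ ((λ z → D₂ (D₁ z)) , λ Dz⊆Dx → s (λ z → Dz⊆Dx (D₂ z)))
          (D₁ , U₁ , inj₂ (_ , s)) (D₂ , U₂ , _) →
            (λ z → D₂ (D₁ z)) , (λ z → U₂ (U₁ z)) ,
            inj₂ ((λ z → U₂ (U₁ z)) , λ Uz⊆Ux → s (λ z → Uz⊆Ux (U₂ z)))
      ; <-resp-≈ =
          (λ {x} {y} {y′} y≈y′ x<y →
             let Dyy′ : D y ⊆ D y′
                 Dyy′ = <-respʳ-≈ y≈y′
                 Uyy′ : U y ⊆ U y′
                 Uyy′ = <-respˡ-≈ y≈y′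
             in right Dyy′ Uyy′ x<y)
        , (λ {y} {x} {x′} x≈x′ x<y →
             let Dx′x : D x′ ⊆ D x
                 Dx′x = <-respʳ-≈ (Eq.sym x≈x′)
                 Ux′x : U x′ ⊆ U x
                 Ux′x = <-respˡ-≈ (Eq.sym x≈x′)
             in left Dx′x Ux′x x<y)
      }
    }
    where
    right : ∀ {x y y′} → D y ⊆ D y′ → U y ⊆ U y′ → x <N y → x <N y′
    right p q (D₁ , U₁ , inj₁ (_ , s)) =
      (λ z → p (D₁ z)) , (λ z → q (U₁ z)) ,
      inj₁ ((λ z → p (D₁ z)) , λ r → s (λ z → r (p z)))
    right p q (D₁ , U₁ , inj₂ (_ , s)) =
      (λ z → p (D₁ z)) , (λ z → q (U₁ z)) ,
      inj₂ ((λ z → q (U₁ z)) , λ r → s (λ z → r (q z)))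

    left : ∀ {x′ x y} → D x′ ⊆ D x → U x′ ⊆ U x → x <N y → x′ <N y
    left p q (D₁ , U₁ , inj₁ (_ , s)) =
      (λ z → D₁ (p z)) , (λ z → U₁ (q z)) ,
      inj₁ ((λ z → D₁ (p z)) , λ r → s (λ z → p (r z)))
    left p q (D₁ , U₁ , inj₂ (_ , s)) =
      (λ z → D₁ (p z)) , (λ z → U₁ (q z)) ,
      inj₂ ((λ z → U₁ (q z)) , λ r → s (λ z → q (r z)))

  InfiniteDescent : Set (a ⊔ ℓ₂)
  InfiniteDescent = Σ[ s ∈ (ℕ → Carrier) ] (∀ n → s (suc n) < s n)

  record WellOrderedLinearExtension ℓ : Set (a ⊔ ℓ₁ ⊔ ℓ₂ ⊔ lsuc ℓ) where
    infix 4 _≺_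
    field
      _≺_                : Rel Carrier ℓ
      isStrictTotalOrder : IsStrictTotalOrder _≈_ _≺_
      extends            : _<_ ⇒ _≺_
      ≺-wellFounded      : WellFounded _≺_

-- Ordinals, represented by well-ordered types; two isomorphic
-- well-ordered types represent the same ordinal.

record Ordinal c ℓ : Set (lsuc (c ⊔ ℓ)) where
  infix 4 _<_
  field
    Carrier            : Set c
    _<_                : Rel Carrier ℓ
    isStrictTotalOrder : IsStrictTotalOrder _≡_ _<_
    <-wellFounded      : WellFounded _<_

  open IsStrictTotalOrder isStrictTotalOrder public
    using (irrefl; trans; compare)

private
  changeEquality : {A : Set a} {_≈₁_ : Rel A ℓ₁} {_<_ : Rel A ℓ₂} →
    _≈₁_ ⇒ _≡_ → _≡_ ⇒ _≈₁_ →
    IsStrictTotalOrder _≈₁_ _<_ → IsStrictTotalOrder _≡_ _<_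
  changeEquality {_≈₁_ = _≈₁_} {_<_} to from sto = record
    { isStrictPartialOrder = record
      { isEquivalence = ≡.isEquivalence
      ; irrefl        = λ x≡y → S.irrefl (from x≡y)
      ; trans         = S.trans
      ; <-resp-≈      = ≡.resp₂ _<_
      }
    ; compare = compare′
    }
    where
    module S = IsStrictTotalOrder sto
    compare′ : Trichotomous _≡_ _<_
    compare′ x y with S.compare x y
    ... | tri< p q r = tri< p (q ∘ from) r
    ... | tri≈ p q r = tri≈ p (to q) r
    ... | tri> p q r = tri> p (q ∘ from) r

fin : ℕ → Ordinal 0ℓ 0ℓ
fin n = record
  { Carrier            = Fin n
  ; _<_                = Fin._<_
  ; isStrictTotalOrder = Fin.<-isStrictTotalOrder
  ; <-wellFounded      = Fin-<-wellFounded
  }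

infixl 6 _+ₒ_
infixl 7 _·ₒ_

_+ₒ_ : Ordinal a ℓ₁ → Ordinal b ℓ₂ → Ordinal (a ⊔ b) (a ⊔ b ⊔ ℓ₁ ⊔ ℓ₂)
A +ₒ B = record
  { Carrier            = A.Carrier ⊎ B.Carrier
  ; _<_                = A._<_ ⊎-< B._<_
  ; isStrictTotalOrder = changeEquality Pointwise-≡⇒≡ ≡⇒Pointwise-≡
      (⊎-<-isStrictTotalOrder A.isStrictTotalOrder B.isStrictTotalOrder)
  ; <-wellFounded      = ⊎-<-wellFounded A.<-wellFounded B.<-wellFounded
  }
  where
  module A = Ordinal A
  module B = Ordinal B

-- A ·ₒ B is B copies of A: pairs are compared first by their
-- B-component, which is therefore put on the left.
_·ₒ_ : Ordinal a ℓ₁ → Ordinal b ℓ₂ → Ordinal (a ⊔ b) (b ⊔ ℓ₁ ⊔ ℓ₂)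
A ·ₒ B = record
  { Carrier            = B.Carrier × A.Carrier
  ; _<_                = ×-Lex _≡_ B._<_ A._<_
  ; isStrictTotalOrder = changeEquality ≡×≡⇒≡ ≡⇒≡×≡
      (×-isStrictTotalOrder B.isStrictTotalOrder A.isStrictTotalOrder)
  ; <-wellFounded      = ×-wellFounded B.<-wellFounded A.<-wellFounded
  }
  where
  module A = Ordinal A
  module B = Ordinal B

-- The ordinal represented by an element ℓ of J: the initial segment
-- below ℓ.  The ordinals less than J are exactly these.
infix 8 _↓_
_↓_ : (J : Ordinal a ℓ₁) → Ordinal.Carrier J → Ordinal (a ⊔ ℓ₁) ℓ₁
J ↓ ℓ = record
  { Carrier            = Refinement J.Carrier (λ k → k J.< ℓ)
  ; _<_                = J._<_ on value
  ; isStrictTotalOrder = changeEquality value-injective (≡.cong value)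
      (On.isStrictTotalOrder value J.isStrictTotalOrder)
  ; <-wellFounded      = On.wellFounded value J.<-wellFounded
  }
  where module J = Ordinal J

module _ (A : Ordinal a ℓ₁) (B : Ordinal b ℓ₂) where
  private
    module A = Ordinal A
    module B = Ordinal B

  infix 4 _≅ₒ_ _≤ₒ_

  _≅ₒ_ : Set (a ⊔ b ⊔ ℓ₁ ⊔ ℓ₂)
  _≅ₒ_ = ∃[ f ] IsOrderIsomorphism _≡_ _≡_ A._<_ B._<_ f

  -- A is isomorphic to an initial segment of B.
  _≤ₒ_ : Set (a ⊔ b ⊔ ℓ₁ ⊔ ℓ₂)
  _≤ₒ_ = Σ[ f ∈ (A.Carrier → B.Carrier) ]
           (∀ {x y} → x A.< y → f x B.< f y)
         × (∀ {x y} → y B.< f x → ∃[ x′ ] (x′ A.< x × f x′ ≡ y))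

infix 4 _<ₒ_
_<ₒ_ : Ordinal a ℓ₁ → Ordinal b ℓ₂ → Set (a ⊔ b ⊔ ℓ₁ ⊔ ℓ₂)
A <ₒ B = ∃[ m ] (A ≅ₒ B ↓ m)

module _ {O : StrictPartialOrder a ℓ₁ ℓ₂} where
  private module O = StrictPartialOrder O

  IsOrderTypeOf : Ordinal b ℓ₄ → WellOrderedLinearExtension O ℓ₃ →
                  Set (a ⊔ b ⊔ ℓ₁ ⊔ ℓ₃ ⊔ ℓ₄)
  IsOrderTypeOf α L = ∃[ f ] IsOrderIsomorphism _≡_ O._≈_ α._<_ L._≺_ f
    where
    module α = Ordinal α
    module L = WellOrderedLinearExtension L

Sequence : Ordinal a ℓ → ∀ c ℓ₁ ℓ₂ → Set (a ⊔ lsuc (c ⊔ ℓ₁ ⊔ ℓ₂))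
Sequence J c ℓ₁ ℓ₂ = Ordinal.Carrier J → StrictPartialOrder c ℓ₁ ℓ₂

module _ (i : Ordinal b ℓ₄) (j : Ordinal a ℓ) (𝒪 : Sequence j c ℓ₁ ℓ₂) where
  private
    module j = Ordinal j
    module 𝒪 k = StrictPartialOrder (𝒪 k)

  record Word : Set (a ⊔ b ⊔ c ⊔ ℓ ⊔ ℓ₄) where
    field
      len    : j.Carrier
      i≤len  : i ≤ₒ j ↓ len
      letter : ∀ k → .(k j.< len) → 𝒪.Carrier k

  open Word

  _≈W_ : Rel Word (a ⊔ ℓ ⊔ ℓ₁)
  X ≈W Y = len X ≡ len Y
         × (∀ k .(p : k j.< len X) .(q : k j.< len Y) →
              𝒪._≈_ k (letter X k p) (letter Y k q))

  record Question (X Y : Word) : Set (a ⊔ ℓ ⊔ ℓ₁) where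
    field
      pos     : j.Carrier
      pos<X   : pos j.< len X
      pos<Y   : pos j.< len Y
      differ  : ¬ 𝒪._≈_ pos (letter X pos pos<X) (letter Y pos pos<Y)
      minimal : ∀ k → k j.< pos → .(p : k j.< len X) .(q : k j.< len Y) →
                𝒪._≈_ k (letter X k p) (letter Y k q)

  _<W_ : Rel Word (a ⊔ ℓ ⊔ ℓ₁ ⊔ ℓ₂)
  X <W Y = Σ[ q ∈ Question X Y ] let open Question q in
             𝒪._<_ pos (letter X pos pos<X) (letter Y pos pos<Y)

  private
    <W-irrefl : ∀ {X Y} → X ≈W Y → ¬ (X <W Y)
    <W-irrefl (_ , eq) (q , _) = differ (eq pos pos<X pos<Y)
      where open Question q

    <W-trans : ∀ {X Y Z} → X <W Y → Y <W Z → X <W Z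
    <W-trans {X} {Y} {Z} (q , x<y) (r , y<z)
      with j.compare (Question.pos q) (Question.pos r)
    ... | tri< k<l _ _ = record
        { pos = Q.pos ; pos<X = Q.pos<X ; pos<Y = k<Z
        ; differ = λ eq → 𝒪.irrefl Q.pos eq x<z
        ; minimal = λ k k< p s → 𝒪.Eq.trans k
            (Q.minimal k k< p (j.trans k< Q.pos<Y))
            (R.minimal k (j.trans k< k<l) (j.trans k< Q.pos<Y) s)
        } , x<z
      where
      module Q = Question q
      module R = Question r
      k<Z = j.trans k<l R.pos<Y
      x<z = 𝒪.<-respʳ-≈ Q.pos (R.minimal Q.pos k<l Q.pos<Y k<Z) x<y
    ... | tri> _ _ l<k = record
        { pos = R.pos ; pos<X = l<X ; pos<Y = R.pos<Y
        ; differ = λ eq → 𝒪.irrefl R.pos eq x<z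
        ; minimal = λ k k< p s → 𝒪.Eq.trans k
            (Q.minimal k (j.trans k< l<k) p (j.trans k< R.pos<X))
            (R.minimal k k< (j.trans k< R.pos<X) s)
        } , x<z
      where
      module Q = Question q
      module R = Question r
      l<X = j.trans l<k Q.pos<X
      x<z = 𝒪.<-respˡ-≈ R.pos
              (𝒪.Eq.sym R.pos (Q.minimal R.pos l<k l<X R.pos<X)) y<z
    ... | tri≈ _ refl _ = record
        { pos = Q.pos ; pos<X = Q.pos<X ; pos<Y = R.pos<Y
        ; differ = λ eq → 𝒪.irrefl Q.pos eq x<z
        ; minimal = λ k k< p s → 𝒪.Eq.trans k
            (Q.minimal k k< p (j.trans k< Q.pos<Y))
            (R.minimal k k< (j.trans k< Q.pos<Y) s)
        } , x<z
      where
      module Q = Question q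
      module R = Question r
      x<z = 𝒪.trans Q.pos x<y y<z

    <W-respʳ : ∀ {X Y Z} → Y ≈W Z → X <W Y → X <W Z
    <W-respʳ (refl , eq) (q , x<y) = record
        { pos = pos ; pos<X = pos<X ; pos<Y = pos<Y
        ; differ = λ e → 𝒪.irrefl pos e x<z
        ; minimal = λ k k< p s → 𝒪.Eq.trans k (minimal k k< p s) (eq k s s)
        } , x<z
      where
      open Question q
      x<z = 𝒪.<-respʳ-≈ pos (eq pos pos<Y pos<Y) x<y

    <W-respˡ : ∀ {X Y Z} → Y ≈W Z → Y <W X → Z <W X
    <W-respˡ (refl , eq) (q , y<x) = record
        { pos = pos ; pos<X = pos<X ; pos<Y = pos<Y
        ; differ = λ e → 𝒪.irrefl pos e z<x
        ; minimal = λ k k< p s →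
            𝒪.Eq.trans k (𝒪.Eq.sym k (eq k p p)) (minimal k k< p s)
        } , z<x
      where
      open Question q
      z<x = 𝒪.<-respˡ-≈ pos (eq pos pos<X pos<X) y<x

  -- i < j is not required here; if j ≤ i there are no words.
  Next : StrictPartialOrder (a ⊔ b ⊔ c ⊔ ℓ ⊔ ℓ₄) (a ⊔ ℓ ⊔ ℓ₁) (a ⊔ ℓ ⊔ ℓ₁ ⊔ ℓ₂)
  Next = record
    { Carrier = Word
    ; _≈_ = _≈W_
    ; _<_ = _<W_
    ; isStrictPartialOrder = record
      { isEquivalence = record
        { refl  = λ {X} → refl , λ k p q → 𝒪.Eq.refl k
        ; sym   = λ { (refl , eq) → refl , λ k p q → 𝒪.Eq.sym k (eq k q p) }
        ; trans = λ { (refl , eq) (refl , eq′) →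
                      refl , λ k p q → 𝒪.Eq.trans k (eq k p p) (eq′ k p q) }
        }
      ; irrefl   = λ {X} {Y} → <W-irrefl {X} {Y}
      ; trans    = λ {X} {Y} {Z} → <W-trans {X} {Y} {Z}
      ; <-resp-≈ = (λ {X} {Y} {Z} → <W-respʳ {X} {Y} {Z})
                 , (λ {X} {Y} {Z} → <W-respˡ {X} {Y} {Z})
      }
    }

O⁰¹ : StrictPartialOrder 0ℓ 0ℓ 0ℓ
O⁰¹ = Fin.<-strictPartialOrder 2

-- c and ℓ are the levels of the ordinals i and j; d, ℓ₃ and ℓ₄ those of
-- the orders O_k.
record QuestionableRepresentation (O : StrictPartialOrder a ℓ₁ ℓ₂) c ℓ d ℓ₃ ℓ₄
       : Set (a ⊔ ℓ₁ ⊔ ℓ₂ ⊔ lsuc (c ⊔ ℓ ⊔ d ⊔ ℓ₃ ⊔ ℓ₄)) where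
  private module O = StrictPartialOrder O
  field
    i j         : Ordinal c ℓ
    i<j         : i <ₒ j
    𝒪           : Sequence j d ℓ₃ ℓ₄
    f           : O.Carrier → Word i j 𝒪
    isEmbedding : IsOrderEmbedding O (Next i j 𝒪) f

  length : Ordinal c ℓ
  length = j

  private
    setoid : Ordinal.Carrier j → Setoid d ℓ₃
    setoid k = record { isEquivalence = StrictPartialOrder.isEquivalence (𝒪 k) }

  WidthAtMost : ℕ → Set (c ⊔ d ⊔ ℓ₃)
  WidthAtMost n = ∀ k → Injection (setoid k) (≡.setoid (Fin n))

  -- The supremum of the cardinalities |Dom(O_k)| is the finite cardinal n.
  HasWidth : ℕ → Set (c ⊔ d ⊔ ℓ₃)
  HasWidth n = WidthAtMost n × (∀ m → WidthAtMost m → n ≤ m)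

  IsTotal : Set (c ⊔ d ⊔ ℓ₃ ⊔ ℓ₄)
  IsTotal = ∀ k → Trichotomous (StrictPartialOrder._≈_ (𝒪 k)) (StrictPartialOrder._<_ (𝒪 k))

  IsBinary : Set (c ⊔ d ⊔ ℓ₃ ⊔ ℓ₄)
  IsBinary = IsTotal × HasWidth 2

{-# OPTIONS --safe #-}

-- Among incomparable elements, N(O) is total up to twins: if z < x but z ≮ y
-- then y <N x, since otherwise O would contain one of the two obstructions.
-- Read the relation of x to the γ-th element z of the linear extension as a
-- pair of bits: 00 for x < z, 01 for x ~ z or x = z, 11 for z < x.  The word
-- of x lists these pairs up to and including the pair of x itself.  Bits are
-- monotone in x, so x < y forces a question, answered correctly, at the
-- latest at the pair of the earlier of the two.  If x ~ y and x precedes y,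
-- the property above makes the word of x a prefix of that of y.

module Submission where

open import Defs
open import Axiom.ExcludedMiddle using (ExcludedMiddle)
open import Data.Empty using (⊥; ⊥-elim)
open import Data.Empty.Irrelevant using () renaming (⊥-elim to ⊥-elim-irr)
import Data.Empty.Polymorphic as Polymorphic
open import Data.Fin.Base as Fin using (Fin; zero)
open import Data.Fin.Patterns using (0F; 1F)
import Data.Fin.Properties as Fin
open import Data.Irrelevant using ([_])
open import Data.Nat.Base using (_≤_; z≤n; s≤s)
open import Data.Product.Base using (_×_; Σ-syntax; ∃; ∃-syntax; _,_; proj₁; proj₂)
open import Data.Refinement using (_,_)
open import Data.Refinement.Properties using (value-injective)
open import Data.Sum.Base using (inj₁; inj₂)
open import Data.Sum.Relation.Binary.LeftOrder using (₁∼₂; ₁∼₁)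
open import Data.Unit.Polymorphic using (⊤)
open import Function.Base using (id; _∘_)
open import Function.Bundles using (Injection)
import Function.Construct.Identity as Identity
open import Induction.WellFounded using (Acc; acc)
open import Level using (Level; _⊔_; 0ℓ)
open import Relation.Binary.Bundles using (StrictPartialOrder)
open import Relation.Binary.Definitions using (tri<; tri≈; tri>)
open import Relation.Binary.Morphism.Structures using (IsOrderIsomorphism)
open import Relation.Binary.PropositionalEquality using (_≡_; refl; sym; cong; subst; isEquivalence; resp₂)
open import Relation.Binary.Structures using (IsStrictTotalOrder)
open import Relation.Nullary using (¬_; Dec; yes; no; contradiction)
open import Relation.Nullary.Decidable using (decidable-stable)
open import Relation.Unary using (Pred; _⊆_)

private
  variable
    a c p q r s t ℓ : Level

-- Truth values as letters.

bit : {P : Set p} → Dec P → Fin 2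
bit (yes _) = 1F
bit (no _)  = 0F

bit-cong : {P : Set p} {Q : Set q} (P? : Dec P) (Q? : Dec Q) →
           (P → Q) → (Q → P) → bit P? ≡ bit Q?
bit-cong (yes _) (yes _) _ _ = refl
bit-cong (no _)  (no _)  _ _ = refl
bit-cong (yes p) (no ¬q) f _ = contradiction (f p) ¬q
bit-cong (no ¬p) (yes q) _ g = contradiction (g q) ¬p

bit-< : {P : Set p} {Q : Set q} (P? : Dec P) (Q? : Dec Q) →
        ¬ P → Q → bit P? Fin.< bit Q?
bit-< (no _)  (yes _) _  _ = s≤s z≤n
bit-< (yes p) _       ¬p _ = contradiction p ¬p
bit-< (no _)  (no ¬q) _  q = contradiction q ¬q

-- The empty ordinal.

emptyₒ : Ordinal a ℓ
emptyₒ = record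
  { Carrier            = Polymorphic.⊥
  ; _<_                = λ ()
  ; isStrictTotalOrder = record
    { isStrictPartialOrder = record
      { isEquivalence = isEquivalence
      ; irrefl        = λ { {()} }
      ; trans         = λ { {()} }
      ; <-resp-≈      = resp₂ _
      }
    ; compare = λ ()
    }
  ; <-wellFounded = λ ()
  }

emptyₒ-≤ₒ : (A : Ordinal p q) → emptyₒ {a} {ℓ} ≤ₒ A
emptyₒ-≤ₒ A = (λ ()) , (λ { {()} }) , λ { {()} }

module WithExcludedMiddle (em : ∀ {ℓ : Level} → ExcludedMiddle ℓ) where

  -- Least elements of well-orders.

  module _ (A : Ordinal a ℓ) where
    open Ordinal A

    IsLeast : Pred Carrier p → Pred Carrier (a ⊔ ℓ ⊔ p)
    IsLeast P m = P m × (∀ k → k < m → ¬ P k)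

    least : (P : Pred Carrier p) → ∃ P → ∃ (IsLeast P)
    least P (k , Pk) = go k Pk (<-wellFounded k)
      where
      go : ∀ k → P k → Acc _<_ k → ∃ (IsLeast P)
      go k Pk (acc rs) with em {P = ∃[ l ] (l < k × P l)}
      ... | yes (l , l<k , Pl) = go l Pl (rs l<k)
      ... | no ∄l              = k , Pk , λ l l<k Pl → ∄l (l , l<k , Pl)

    -- The initial segment below the least element is empty.
    emptyₒ-<ₒ : Carrier → emptyₒ {p} {q} <ₒ A
    emptyₒ-<ₒ k = m , (λ ()) , record
      { isOrderMonomorphism = record
        { isOrderHomomorphism = record { cong = λ { {()} } ; mono = λ { {()} } }
        ; injective = λ { {()} }
        ; cancel    = λ { {()} }
        }
      ; surjective = λ (x , [ x<m ]) → ⊥-elim-irr (nothing-below x x<m _)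
      }
      where
      l = least (λ _ → ⊤ {0ℓ}) (k , _)
      m = proj₁ l
      nothing-below = proj₂ (proj₂ l)

  -- Consequences of property (itov) for the neighbourhood order.

  module _ (O : StrictPartialOrder a p q) (itov : Itov O) where
    open StrictPartialOrder O renaming (irrefl to <-irrefl; trans to <-trans)

    -- The three negations exclude every further equality or comparability except `c < b`: for
    -- instance `b < c` would give `a < d`, and `d < a` would give `d < b`. Whether `c < b` holds
    -- selects the obstruction.
    no-obstruction : ∀ {a b c d} → a < b → c < d →
                     ¬ a < d → ¬ c < a → ¬ d < b → ⊥
    no-obstruction {a} {b} {c} {d} ab cd ¬ad ¬ca ¬db = byCases em
      where
      ⟦_⟧ : Four → Carrier
      ⟦ a′ ⟧ = a
      ⟦ b′ ⟧ = b
      ⟦ c′ ⟧ = c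
      ⟦ d′ ⟧ = d

      ⟦⟧-injective : ∀ {u v} → ⟦ u ⟧ ≈ ⟦ v ⟧ → u ≡ v
      ⟦⟧-injective {a′} {a′} _ = refl
      ⟦⟧-injective {a′} {b′} e = contradiction ab (<-irrefl e)
      ⟦⟧-injective {a′} {c′} e = contradiction (<-respˡ-≈ (Eq.sym e) cd) ¬ad
      ⟦⟧-injective {a′} {d′} e = contradiction (<-respʳ-≈ (Eq.sym e) cd) ¬ca
      ⟦⟧-injective {b′} {a′} e = contradiction ab (<-irrefl (Eq.sym e))
      ⟦⟧-injective {b′} {b′} _ = refl
      ⟦⟧-injective {b′} {c′} e = contradiction (<-trans (<-respʳ-≈ e ab) cd) ¬ad
      ⟦⟧-injective {b′} {d′} e = contradiction (<-respʳ-≈ e ab) ¬ad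
      ⟦⟧-injective {c′} {a′} e = contradiction (<-respˡ-≈ e cd) ¬ad
      ⟦⟧-injective {c′} {b′} e = contradiction (<-trans (<-respʳ-≈ (Eq.sym e) ab) cd) ¬ad
      ⟦⟧-injective {c′} {c′} _ = refl
      ⟦⟧-injective {c′} {d′} e = contradiction cd (<-irrefl e)
      ⟦⟧-injective {d′} {a′} e = contradiction (<-respʳ-≈ e cd) ¬ca
      ⟦⟧-injective {d′} {b′} e = contradiction (<-respʳ-≈ (Eq.sym e) ab) ¬ad
      ⟦⟧-injective {d′} {c′} e = contradiction cd (<-irrefl (Eq.sym e))
      ⟦⟧-injective {d′} {d′} _ = refl

      ⟦⟧-cancel : (_<′_ : Four → Four → Set) → a′ <′ b′ → c′ <′ d′ →
                  (c < b → c′ <′ b′) → ∀ {u v} → ⟦ u ⟧ < ⟦ v ⟧ → u <′ v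
      ⟦⟧-cancel _ _ _ _ {a′} {a′} l = contradiction l (<-irrefl Eq.refl)
      ⟦⟧-cancel _ ab′ _ _ {a′} {b′} l = ab′
      ⟦⟧-cancel _ _ _ _ {a′} {c′} l = contradiction (<-trans l cd) ¬ad
      ⟦⟧-cancel _ _ _ _ {a′} {d′} l = contradiction l ¬ad
      ⟦⟧-cancel _ _ _ _ {b′} {a′} l = contradiction (<-trans l ab) (<-irrefl Eq.refl)
      ⟦⟧-cancel _ _ _ _ {b′} {b′} l = contradiction l (<-irrefl Eq.refl)
      ⟦⟧-cancel _ _ _ _ {b′} {c′} l = contradiction (<-trans ab (<-trans l cd)) ¬ad
      ⟦⟧-cancel _ _ _ _ {b′} {d′} l = contradiction (<-trans ab l) ¬ad
      ⟦⟧-cancel _ _ _ _ {c′} {a′} l = contradiction l ¬ca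
      ⟦⟧-cancel _ _ _ cb′ {c′} {b′} l = cb′ l
      ⟦⟧-cancel _ _ _ _ {c′} {c′} l = contradiction l (<-irrefl Eq.refl)
      ⟦⟧-cancel _ _ cd′ _ {c′} {d′} l = cd′
      ⟦⟧-cancel _ _ _ _ {d′} {a′} l = contradiction (<-trans l ab) ¬db
      ⟦⟧-cancel _ _ _ _ {d′} {b′} l = contradiction l ¬db
      ⟦⟧-cancel _ _ _ _ {d′} {c′} l = contradiction (<-trans l cd) (<-irrefl Eq.refl)
      ⟦⟧-cancel _ _ _ _ {d′} {d′} l = contradiction l (<-irrefl Eq.refl)

      byCases : Dec (c < b) → ⊥
      byCases (yes cb) = proj₂ itov (⟦_⟧ , record
        { isOrderHomomorphism = record
          { cong = Eq.reflexive ∘ cong ⟦_⟧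
          ; mono = λ { a<b → ab ; c<d → cd ; c<b → cb }
          }
        ; injective = ⟦⟧-injective
        ; cancel    = ⟦⟧-cancel _<₂_ a<b c<d λ _ → c<b
        })
      byCases (no ¬cb) = proj₁ itov (⟦_⟧ , record
        { isOrderHomomorphism = record
          { cong = Eq.reflexive ∘ cong ⟦_⟧
          ; mono = λ { a<b → ab ; c<d → cd }
          }
        ; injective = ⟦⟧-injective
        ; cancel    = ⟦⟧-cancel _<₁_ a<b c<d λ cb → contradiction cb ¬cb
        })

    -- A counterexample `w` to either inclusion makes `z < x` together with `w < y` or `y < w` an
    -- obstruction.
    ¬D⊆⇒>N : ∀ {x y z} → ¬ y < x → z < x → ¬ z < y → _<N_ O y x
    ¬D⊆⇒>N {x} {y} {z} y≮x z<x z≮y =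
      Dy⊆Dx , Uy⊆Ux , inj₁ (Dy⊆Dx , λ Dx⊆Dy → z≮y (Dx⊆Dy z<x))
      where
      Dy⊆Dx : D O y ⊆ D O x
      Dy⊆Dx w<y = decidable-stable em λ w≮x →
        no-obstruction z<x w<y z≮y (λ w<z → w≮x (<-trans w<z z<x)) y≮x

      Uy⊆Ux : U O y ⊆ U O x
      Uy⊆Ux y<w = decidable-stable em λ x≮w →
        no-obstruction y<w z<x y≮x z≮y x≮w

    -- Again by obstruction, with the chain `x < z`. Now `x < y` has to be excluded by hypothesis:
    -- `z = y` shows that it is compatible with `x < z` and `¬ y < z`.
    ¬U⊆⇒>N : ∀ {x y z} → ¬ x < y → ¬ y < x → x < z → ¬ y < z → _<N_ O y x
    ¬U⊆⇒>N {x} {y} {z} x≮y y≮x x<z y≮z =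
      Dy⊆Dx , Uy⊆Ux , inj₂ (Uy⊆Ux , λ Ux⊆Uy → y≮z (Ux⊆Uy x<z))
      where
      Dy⊆Dx : D O y ⊆ D O x
      Dy⊆Dx w<y = decidable-stable em λ w≮x →
        no-obstruction x<z w<y x≮y w≮x y≮z

      Uy⊆Ux : U O y ⊆ U O x
      Uy⊆Ux y<w = decidable-stable em λ x≮w →
        no-obstruction x<z y<w x≮w y≮x (λ w<z → y≮z (<-trans y<w w<z))

    -- The well-ordered extension on incomparable elements.

    module _ (L : WellOrderedLinearExtension (N O) r) where
      open WellOrderedLinearExtension L
      private module ≺ = IsStrictTotalOrder isStrictTotalOrder

      -- A `z` violating the inclusion would put `y` before `x` in `N O`, hence in `≺`.
      incomparable-≺⇒D⊆ : ∀ {x y} → ¬ y < x → x ≺ y → D O x ⊆ D O y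
      incomparable-≺⇒D⊆ y≮x x≺y z<x = decidable-stable em λ z≮y →
        ≺.asym x≺y (extends (¬D⊆⇒>N y≮x z<x z≮y))

      incomparable-≺⇒U⊆ : ∀ {x y} → ¬ x < y → ¬ y < x → x ≺ y → U O x ⊆ U O y
      incomparable-≺⇒U⊆ x≮y y≮x x≺y x<z = decidable-stable em λ y≮z →
        ≺.asym x≺y (extends (¬U⊆⇒>N x≮y y≮x x<z y≮z))

      -- If `z` were not below `x`, the two would be incomparable, since `x < z` would give `x < y`;
      -- then `U z ⊆ U x` would put `y` above `x`.
      ≺-reflects-D : ∀ {x y z} → ¬ x < y → z ≺ x → z < y → z < x
      ≺-reflects-D x≮y z≺x z<y = decidable-stable em λ z≮x →
        x≮y (incomparable-≺⇒U⊆ z≮x (λ x<z → x≮y (<-trans x<z z<y)) z≺x z<y)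

      -- If `x` were not below `z`, then `D z ⊆ D x` would put `y` below `x`.
      ≺-reflects-U : ∀ {x y z} → ¬ y < x → z ≺ x → y < z → x < z
      ≺-reflects-U y≮x z≺x y<z = decidable-stable em λ x≮z →
        y≮x (incomparable-≺⇒D⊆ x≮z z≺x y<z)

      -- Positions and word lengths.

      module _ (α : Ordinal c ℓ) (iso : IsOrderTypeOf α L) where
        private
          module α = Ordinal α
          f = proj₁ iso
          module f = IsOrderIsomorphism (proj₂ iso)

        2·α+1 : Ordinal c (c ⊔ ℓ)
        2·α+1 = fin 2 ·ₒ α +ₒ fin 1

        private module J = Ordinal 2·α+1

        g : Carrier → α.Carrier
        g x = proj₁ (f.surjective x)

        f∘g : ∀ x → f (g x) ≈ x
        f∘g x = proj₂ (f.surjective x) refl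

        g-cong : ∀ {x y} → x ≈ y → g x ≡ g y
        g-cong {x} {y} x≈y =
          f.injective (Eq.trans (f∘g x) (Eq.trans x≈y (Eq.sym (f∘g y))))

        g-injective : ∀ {x y} → g x ≡ g y → x ≈ y
        g-injective {x} {y} e =
          Eq.trans (Eq.sym (f∘g x)) (Eq.trans (Eq.reflexive (cong f e)) (f∘g y))

        f-≺ : ∀ {γ x} → γ α.< g x → f γ ≺ x
        f-≺ {x = x} γ<gx = ≺.<-respʳ-≈ (f∘g x) (f.mono γ<gx)

        g-reflects-< : ∀ {x y} → g x α.< g y → x ≺ y
        g-reflects-< {x} gx<gy = ≺.<-respˡ-≈ (f∘g x) (f-≺ gx<gy)

        last : Carrier → J.Carrier
        last x = inj₁ (g x , 1F)

        last-mono : ∀ {x y} → g x α.< g y → last x J.< last y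
        last-mono gx<gy = ₁∼₁ (inj₁ gx<gy)

        successor : ∀ γ → ∃ (IsLeast 2·α+1 (inj₁ (γ , 1F) J.<_))
        -- The extra top position `inj₂ zero` lies above every pair, so a successor exists even when
        -- `γ` is the greatest element of `α`.
        successor γ = least 2·α+1 _ (inj₂ zero , ₁∼₂)

        -- Lengths are exclusive bounds: taking the successor makes `last x` the final position of
        -- the word.
        len : Carrier → J.Carrier
        len x = proj₁ (successor (g x))

        last<len : ∀ x → last x J.< len x
        last<len x = proj₁ (proj₂ (successor (g x)))

        last≮⇐<len : ∀ x {k} → k J.< len x → ¬ last x J.< k
        last≮⇐<len x = proj₂ (proj₂ (successor (g x))) _

        pair<len : ∀ x {γ} i → ¬ g x α.< γ → inj₁ (γ , i) J.< len x
        pair<len x {γ} i gx≮γ with α.compare γ (g x)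
        pair<len x i gx≮γ  | tri< γ<gx _ _ = J.trans (₁∼₁ (inj₁ γ<gx)) (last<len x)
        pair<len x 0F gx≮γ | tri≈ _ refl _ = J.trans (₁∼₁ (inj₂ (refl , s≤s z≤n))) (last<len x)
        pair<len x 1F gx≮γ | tri≈ _ refl _ = last<len x
        pair<len x i gx≮γ  | tri> _ _ gx<γ = contradiction gx<γ gx≮γ

        -- If `len y` were at most `len x`, then `last y` would be below `len x`, hence not beyond
        -- `last x`.
        len-mono : ∀ {x y} → g x α.< g y → len x J.< len y
        len-mono {x} {y} gx<gy with J.compare (len x) (len y)
        ... | tri< l _ _ = l
        ... | tri≈ _ e _ = contradiction (last-mono {x} {y} gx<gy)
                (last≮⇐<len x (subst (last y J.<_) (sym e) (last<len y)))
        ... | tri> _ _ l = contradiction (last-mono {x} {y} gx<gy)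
                (last≮⇐<len x (J.trans (last<len y) l))

        -- The conditions behind the bits, and where they agree or separate.

        At : J.Carrier → Carrier → Set q
        At (inj₁ (γ , 0F)) x = f γ < x
        -- The negation makes this condition, like the first, pass from `x` to anything larger.
        At (inj₁ (γ , 1F)) x = ¬ x < f γ
        -- The top position lies below no length; a constant value keeps the lemmas on `At` trivial
        -- there.
        At (inj₂ _)        x = ⊤

        At-mono : ∀ k {x y} → x < y → At k x → At k y
        At-mono (inj₁ (γ , 0F)) x<y γ<x     = <-trans γ<x x<y
        At-mono (inj₁ (γ , 1F)) x<y x≮γ y<γ = x≮γ (<-trans x<y y<γ)
        At-mono (inj₂ _)        _   _       = _

        At-resp-≈ : ∀ k {x y} → x ≈ y → At k x → At k y
        At-resp-≈ (inj₁ (γ , 0F)) x≈y γ<x     = <-respʳ-≈ x≈y γ<x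
        At-resp-≈ (inj₁ (γ , 1F)) x≈y x≮γ y<γ = x≮γ (<-respˡ-≈ (Eq.sym x≈y) y<γ)
        At-resp-≈ (inj₂ _)        _   _       = _

        -- Before the pair of `x`, one direction for each bit is the inclusion of `D` or `U`, and
        -- the other is reflection along `≺`.
        At-prefix : ∀ {x y} → ¬ x < y → ¬ y < x → g x α.< g y →
                    ∀ k → ¬ last x J.< k → (At k x → At k y) × (At k y → At k x)
        At-prefix x≮y y≮x gx<gy (inj₂ _) _ = _
        At-prefix {x} {y} x≮y y≮x gx<gy (inj₁ (γ , i)) ≮k with α.compare γ (g x)
        At-prefix {x} {y} x≮y y≮x gx<gy (inj₁ (γ , i)) ≮k | tri> _ _ gx<γ =
          contradiction (₁∼₁ (inj₁ gx<γ)) ≮k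
        At-prefix {x} {y} x≮y y≮x gx<gy (inj₁ (γ , 0F)) ≮k | tri< γ<gx _ _ =
          incomparable-≺⇒D⊆ y≮x (g-reflects-< gx<gy) ,
          ≺-reflects-D x≮y (f-≺ γ<gx)
        At-prefix {x} {y} x≮y y≮x gx<gy (inj₁ (γ , 1F)) ≮k | tri< γ<gx _ _ =
          (λ x≮γ y<γ → x≮γ (≺-reflects-U y≮x (f-≺ γ<gx) y<γ)) ,
          (λ y≮γ x<γ → y≮γ (incomparable-≺⇒U⊆ x≮y y≮x (g-reflects-< gx<gy) x<γ))
        -- At the own pair of `x` both elements read 01: `f γ` is `x` itself, which is incomparable
        -- to `y`.
        At-prefix {x} {y} x≮y y≮x gx<gy (inj₁ (γ , 0F)) ≮k | tri≈ _ refl _ =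
          (λ γ<x → contradiction γ<x (<-irrefl (f∘g x))) ,
          (λ γ<y → contradiction (<-respˡ-≈ (f∘g x) γ<y) x≮y)
        At-prefix {x} {y} x≮y y≮x gx<gy (inj₁ (γ , 1F)) ≮k | tri≈ _ refl _ =
          (λ _ y<γ → y≮x (<-respʳ-≈ (f∘g x) y<γ)) ,
          (λ _ → <-irrefl (Eq.sym (f∘g x)))

        At-agree : ∀ {x y} → ¬ x < y → ¬ y < x → ∀ k → k J.< len x → k J.< len y →
                   (At k x → At k y) × (At k y → At k x)
        At-agree {x} {y} x≮y y≮x k k<x k<y with α.compare (g x) (g y)
        ... | tri< gx<gy _ _ = At-prefix x≮y y≮x gx<gy k (last≮⇐<len x k<x)
        ... | tri≈ _ gx≡gy _ =
              At-resp-≈ k (g-injective gx≡gy) , At-resp-≈ k (g-injective (sym gx≡gy))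
        ... | tri> _ _ gy<gx =
              let to , from = At-prefix y≮x x≮y gy<gx k (last≮⇐<len y k<y) in from , to

        Separates : Carrier → Carrier → J.Carrier → Set q
        Separates x y k = ¬ At k x × At k y

        separate : ∀ {x y} → x < y →
                   ∃[ k ] (k J.< len x × k J.< len y × Separates x y k)
        separate {x} {y} x<y with α.compare (g x) (g y)
        -- At the first bit of its own pair `x` reads 0, while `y`, being above `x`, reads 1.
        ... | tri< gx<gy _ gy≮gx = inj₁ (g x , 0F) ,
              pair<len x 0F (α.irrefl refl) , pair<len y 0F gy≮gx ,
              <-irrefl (f∘g x) , <-respˡ-≈ (Eq.sym (f∘g x)) x<y
        ... | tri≈ _ gx≡gy _ = contradiction x<y (<-irrefl (g-injective gx≡gy))
        -- At the second bit of its own pair `y` reads 1, while `x`, being below `y`, reads 0.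
        ... | tri> gx≮gy _ gy<gx = inj₁ (g y , 1F) ,
              pair<len x 1F gx≮gy , pair<len y 1F (α.irrefl refl) ,
              (λ x≮gy → x≮gy (<-respʳ-≈ (Eq.sym (f∘g y)) x<y)) ,
              <-irrefl (Eq.sym (f∘g y))

        letter : Carrier → J.Carrier → Fin 2
        letter x k = bit (em {P = At k x})

        letter-cong : ∀ {x y} k → (At k x → At k y) → (At k y → At k x) →
                      letter x k ≡ letter y k
        letter-cong k = bit-cong em em

        𝒪⁰¹ : Sequence 2·α+1 0ℓ 0ℓ 0ℓ
        𝒪⁰¹ _ = O⁰¹

        -- The embedding by words, for any lower bound `i` on their lengths.

        module _ {i : Ordinal s t} (i≤len : ∀ x → i ≤ₒ 2·α+1 ↓ len x) where

          private module W = StrictPartialOrder (Next i 2·α+1 𝒪⁰¹)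

          word : Carrier → Word i 2·α+1 𝒪⁰¹
          word x = record
            { len = len x ; i≤len = i≤len x ; letter = λ k _ → letter x k }

          word-cong : ∀ {x y} → x ≈ y → word x W.≈ word y
          word-cong x≈y =
            cong (proj₁ ∘ successor) (g-cong x≈y) ,
            λ k _ _ → letter-cong k (At-resp-≈ k x≈y) (At-resp-≈ k (Eq.sym x≈y))

          -- The question is the least separating position; the one given by `separate` bounds it
          -- and so places it inside both words.
          word-mono : ∀ {x y} → x < y → word x W.< word y
          word-mono {x} {y} x<y =
            let k , k<x , k<y , sep = separate x<y
                m , (¬mx , my) , minimal = least 2·α+1 (Separates x y) (k , sep)
                letter< = bit-< em em ¬mx my
            in record
              { pos     = m
              ; pos<X   = below m k minimal sep k<x
              ; pos<Y   = below m k minimal sep k<y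
              ; differ  = λ e → Fin.<-irrefl e letter<
              -- Bits can only rise from `x` to `y`, so a difference before `m` would be an earlier
              -- separation.
              ; minimal = λ l l<m _ _ → letter-cong l (At-mono l x<y)
                  λ ly → decidable-stable em λ ¬lx → minimal l l<m (¬lx , ly)
              } , letter<
            where
            below : ∀ m k {l} → (∀ k → k J.< m → ¬ Separates x y k) →
                    Separates x y k → k J.< l → m J.< l
            below m k minimal sep k<l with J.compare m k
            ... | tri< m<k _ _  = J.trans m<k k<l
            ... | tri≈ _ refl _ = k<l
            ... | tri> _ _ k<m  = contradiction sep (minimal k k<m)

          -- By `word-mono`, `y < x` is impossible. If `x < y` failed too, the words would agree
          -- wherever both are defined, leaving no question.
          word-cancel : ∀ {x y} → word x W.< word y → x < y
          word-cancel {x} {y} X<Y@(q , _) = decidable-stable em λ x≮y →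
            let y≮x = λ y<x → W.irrefl (W.Eq.refl {word x})
                                (W.trans {word x} {word y} {word x} X<Y (word-mono y<x))
                to , from = At-agree x≮y y≮x pos pos<X pos<Y
            in differ (letter-cong pos to from)
            where open Question q

          -- The word of one element may be a prefix of another's, so injectivity is read off the
          -- lengths, which increase strictly with `g`.
          word-injective : ∀ {x y} → word x W.≈ word y → x ≈ y
          word-injective {x} {y} (len≡ , _) with α.compare (g x) (g y)
          ... | tri< gx<gy _ _ = contradiction (len-mono {x} {y} gx<gy) (J.irrefl len≡)
          ... | tri≈ _ gx≡gy _ = g-injective gx≡gy
          ... | tri> _ _ gy<gx = contradiction (len-mono {y} {x} gy<gx) (J.irrefl (sym len≡))

          word-isOrderEmbedding : IsOrderEmbedding O (Next i 2·α+1 𝒪⁰¹) word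
          word-isOrderEmbedding = record
            { isOrderHomomorphism = record
              { cong = word-cong
              ; mono = word-mono
              }
            ; injective = word-injective
            ; cancel    = λ {x} {y} → word-cancel {x} {y}
            }

        -- Every word contains the pair of the least element `β` of `α`, and the positions of this
        -- pair are the first two.
        2≤len : ∀ x → fin 2 ≤ₒ 2·α+1 ↓ len x
        2≤len x = (λ i → inj₁ (β , i) , [ pair<len x i (λ gx<β → nothing-below _ gx<β _) ]) ,
          (λ i<j → ₁∼₁ (inj₂ (refl , i<j))) ,
          λ { {y = inj₁ (γ , i) , _} (₁∼₁ (inj₁ γ<β))          → ⊥-elim (nothing-below γ γ<β _)
            ; {y = inj₁ (γ , i) , _} (₁∼₁ (inj₂ (refl , i<j))) → i , i<j , value-injective refl
            }
          where
          l = least α (λ _ → ⊤ {0ℓ}) (g x , _)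
          β = proj₁ l
          nothing-below = proj₂ (proj₂ l)

theorem4p4 : (em : ∀ {ℓ : Level} → ExcludedMiddle ℓ) →
    ∀ {c ℓ₁ ℓ₂ ℓ₃ d ℓ₄ : Level} (O : StrictPartialOrder c ℓ₁ ℓ₂) →
    Itov O →
    ¬ InfiniteDescent (N O) →
    (L : WellOrderedLinearExtension (N O) ℓ₃) →
    (α : Ordinal d ℓ₄) → IsOrderTypeOf α L →
    let 2·α+1 = fin 2 ·ₒ α +ₒ fin 1 in
    (Σ[ R ∈ QuestionableRepresentation O d (d ⊔ ℓ₄) 0ℓ 0ℓ 0ℓ ]
    QuestionableRepresentation.IsTotal R
    × QuestionableRepresentation.IsBinary R
    × QuestionableRepresentation.length R ≤ₒ 2·α+1)
    × OrderEmbedding O (Next (fin 2) 2·α+1 (λ _ → O⁰¹))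
theorem4p4 em {d = d} {ℓ₄} O itov _ L α iso =
  -- The length is `2·α+1` itself, so the identity serves as the initial embedding.
  (R , total , (total , width≤2 , 2≤width) , id , id , λ y<x → _ , y<x , refl) ,
  word O itov L α iso (2≤len O itov L α iso) ,
  word-isOrderEmbedding O itov L α iso (2≤len O itov L α iso)
  where
  open WithExcludedMiddle em

  j = 2·α+1 O itov L α iso

  -- The lower bound i = 0 instead of 2 also covers empty O, where 2·α+1 = 1.
  0≤len : ∀ x → emptyₒ ≤ₒ j ↓ len O itov L α iso x
  0≤len x = emptyₒ-≤ₒ (j ↓ len O itov L α iso x)

  R : QuestionableRepresentation O d (d ⊔ ℓ₄) 0ℓ 0ℓ 0ℓ
  R = record
    { i           = emptyₒ
    ; j           = j
    ; i<j         = emptyₒ-<ₒ j (inj₂ zero)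
    ; 𝒪           = λ _ → O⁰¹
    ; f           = word O itov L α iso 0≤len
    ; isEmbedding = word-isOrderEmbedding O itov L α iso 0≤len
    }

  open QuestionableRepresentation R

  total : IsTotal
  total _ = Fin.<-cmp

  width≤2 : WidthAtMost 2
  width≤2 _ = Identity.injection _

  2≤width : ∀ m → WidthAtMost m → 2 ≤ m
  -- `inj₂ zero` is a position whatever `α` is, so an injection of the two letters into `Fin m` is
  -- always at hand.
  2≤width m inj = Fin.injective⇒≤ (Injection.injective (inj (inj₂ zero)))
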